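{- Let $m$ be a positive integer with $m\not\equiv 1\pmod 3$. Then the function $f:\mathbb{F}_{2^{3m}}\to\mathbb{F}_{2^{3m}}$, $$f(x)=x^{2^{2m}+1}+x^{2^{2m}+2^m},$$ is pseudo-planar on $\mathbb{F}_{2^{3m}}$.
   Context: A function $f:\mathbb{F}_{2^n}\to\mathbb{F}_{2^n}$ is called pseudo-planar if for every $\epsilon\in\mathbb{F}_{2^n}^*$ the map $x\mapsto f(x+\epsilon)+f(x)+\epsilon x$ is a permutation of $\mathbb{F}_{2^n}$. -}

module Defs where

open import Algebra.Apartness.Bundles using (HeytingField; HeytingCommutativeRing)
open import Algebra.Bundles using (CommutativeRing)
open import Data.Fin.Base using (Fin)
open import Data.Nat.Base as ℕ using (ℕ)
open import Function.Bundles using (Inverse)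
open import Function.Structures using (IsBijection)
open import Level using (Level; _⊔_)
import Algebra.Properties.Semiring.Exp as Exp
import Relation.Binary.PropositionalEquality.Properties as ≡

private
  variable
    c ℓ₁ ℓ₂ : Level

-- If K is finite then _≈_ is decidable, and hence so is invertibility; since
-- the apartness is tight, every x ≉ 0# is then invertible.  So a HeytingField K
-- with HasOrder K q is exactly a field with q elements.  Quantifying over all
-- such K with q = 2 ^ n covers every model of the finite field with 2 ^ n
-- elements, which is unique up to isomorphism.
HasOrder : HeytingField c ℓ₁ ℓ₂ → ℕ → Set (c ⊔ ℓ₁)
HasOrder K q = Inverse (HeytingField.setoid K) (≡.setoid (Fin q))

module _ (K : HeytingField c ℓ₁ ℓ₂) where
  open HeytingField K
  open CommutativeRing (HeytingCommutativeRing.commutativeRing heytingCommutativeRing)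
    using (semiring; _≉_)
  open Exp semiring using (_^_)

  -- IsBijection includes congruence, so this says that each of the maps is a
  -- well-defined permutation of the carrier modulo _≈_.
  IsPseudoPlanar : (Carrier → Carrier) → Set (c ⊔ ℓ₁)
  IsPseudoPlanar f =
    ∀ ε → ε ≉ 0# → IsBijection _≈_ _≈_ (λ x → f (x + ε) + f x + ε * x)

  binomial : ℕ → Carrier → Carrier
  binomial m x =
      x ^ (2 ℕ.^ (2 ℕ.* m) ℕ.+ 1)
    + x ^ (2 ℕ.^ (2 ℕ.* m) ℕ.+ 2 ℕ.^ m)

{-# OPTIONS --safe #-}

-- Write a, b, c for ε and its conjugates under σ(x) = x^(2^m), an automorphism
-- of order 3.  The difference of two values of x ↦ f(x + ε) + f(x) + εx is a
-- σ-linearised form in the difference of the arguments, and its determinant is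
-- the norm from F₈ to F₂ of the linear form (a + c) + θb + θ²c, with
-- θ³ + θ² + 1 = 0.  If the norm vanishes, then θ can be taken in the field:
-- it is a quotient of quadratic forms in a, b, c, or c / b when these forms
-- vanish.  Since m ≢ 1 (mod 3), σ sends θ to θ or to θ⁴, and then the linear
-- form and its two conjugates are linearly independent, which forces a = 0.

module Submission where

open import Defs
open import Algebra.Apartness.Bundles using (HeytingField; HeytingCommutativeRing)
open import Algebra.Bundles using (CommutativeMonoid; CommutativeRing; RawRing)
open import Algebra.Solver.Ring.AlmostCommutativeRing
  using (fromCommutativeRing; _-Raw-AlmostCommutative⟶_)
open import Data.Bool.Base using (Bool; true; false; if_then_else_)
open import Data.Bool.Properties using (xor-∧-commutativeRing) renaming (_≟_ to _≟ᵇ_)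
open import Data.Fin.Base using (Fin; zero; suc; punchOut)
open import Data.Fin.Properties using (any?; punchOut-injective; injective⇒≤)
  renaming (_≟_ to _≟ᶠ_)
open import Data.Maybe.Base as Maybe using (Maybe)
open import Data.Nat.Base as ℕ using (ℕ; zero; suc; NonZero)
open import Data.Nat.DivMod using (m≡m%n+[m/n]*n; m%n<n)
import Data.Nat.Properties as ℕ
open import Data.Product.Base using (∃-syntax; _×_; _,_; proj₁)
open import Data.Sum.Base using (_⊎_; inj₁; inj₂)
open import Function.Base using (_∘_; id)
open import Function.Bundles using (Inverse)
open import Function.Construct.Composition using () renaming (inverse to _⨾_)
open import Function.Construct.Symmetry using () renaming (inverse to invert)
open import Function.Definitions using (Congruent; Injective; Surjective)
open import Function.Structures using (IsBijection)
open import Relation.Binary.Bundles using (Setoid)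
open import Relation.Binary.Definitions using (Decidable)
open import Relation.Binary.PropositionalEquality.Core as ≡ using (_≡_; _≢_)
import Relation.Binary.PropositionalEquality.Properties as ≡
import Relation.Binary.Reasoning.Setoid as SetoidReasoning
open import Relation.Nullary.Decidable using (yes; no; does; map′; dec⇒maybe)
open import Relation.Nullary.Negation using (¬_; contradiction)
import Algebra.Properties.CommutativeMonoid.Sum as Sum
import Algebra.Properties.CommutativeSemiring.Exp as Exp
import Algebra.Properties.Group as GroupProperties
import Algebra.Properties.Ring as RingProperties
import Algebra.Properties.Semiring.Mult as Mult
import Algebra.Solver.Ring as RingSolver

-- The polynomial forms of the argument.

-- Stated over a bare signature, so that the forms can be evaluated both in a
-- ring and in the syntax of the ring solver.
module Forms {a} {A : Set a} (_+_ _*_ : A → A → A) (1# : A) where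
  private
    infixl 6 _⊕_
    infixl 7 _⊗_
    _⊕_ = _+_
    _⊗_ = _*_

  trinomial : A → A → A → A
  trinomial x y z = x ⊗ z ⊕ z ⊗ y

  linearised : A → A → A → A → A → A → A
  linearised a b c x y z = x ⊗ (a ⊕ c) ⊕ y ⊗ c ⊕ z ⊗ (a ⊕ b)

  -- The product of `linear a b c θ` over the three roots θ of `minimal`, written out so that no
  -- root has to be adjoined.
  norm : A → A → A → A
  norm a b c =
    a ⊗ a ⊗ a ⊕ b ⊗ b ⊗ b ⊕ c ⊗ c ⊗ c
    ⊕ a ⊗ c ⊗ c ⊕ c ⊗ b ⊗ b ⊕ b ⊗ a ⊗ a ⊕ a ⊗ b ⊗ c

  linear : A → A → A → A → A
  linear a b c t = a ⊕ c ⊕ t ⊗ b ⊕ t ⊗ t ⊗ c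

  linearʰ : A → A → A → A → A → A
  linearʰ a b c n d = d ⊗ d ⊗ (a ⊕ c) ⊕ n ⊗ d ⊗ b ⊕ n ⊗ n ⊗ c

  minimal : A → A
  minimal t = t ⊗ t ⊗ t ⊕ t ⊗ t ⊕ 1#

  minimalʰ : A → A → A
  minimalʰ n d = n ⊗ n ⊗ n ⊕ n ⊗ n ⊗ d ⊕ d ⊗ d ⊗ d

  -- Eliminating t² from linear a b c t = 0 and t * linear a b c t = 0 modulo
  -- minimal t leaves numerator a b c = t * denominator a b c.
  numerator denominator : A → A → A → A
  numerator a b c = a ⊗ b ⊕ a ⊗ c ⊕ b ⊗ c
  denominator a b c = b ⊗ b ⊕ b ⊗ c ⊕ a ⊗ c ⊕ c ⊗ c

  θ⁴-reduced : A → A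
  θ⁴-reduced t = t ⊗ t ⊕ t ⊕ 1#

-- Polynomial identities in characteristic two.

HasCharacteristicTwo : ∀ {c ℓ} → CommutativeRing c ℓ → Set ℓ
HasCharacteristicTwo R = 1# + 1# ≈ 0#
  where open CommutativeRing R

module CharacteristicTwo {c ℓ} (R : CommutativeRing c ℓ) (1+1≈0 : HasCharacteristicTwo R) where

  open CommutativeRing R hiding (zero)
  open Exp commutativeSemiring
  open SetoidReasoning setoid

  F₂ : RawRing _ _
  F₂ = CommutativeRing.rawRing xor-∧-commutativeRing

  ⟦_⟧ : Bool → Carrier
  ⟦ b ⟧ = if b then 1# else 0#

  -- With coefficients taken in F₂, the ring solver collects terms modulo 2 and so proves identities
  -- special to characteristic two.
  F₂⟶R : F₂ -Raw-AlmostCommutative⟶ fromCommutativeRing R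
  F₂⟶R = record
    { ⟦_⟧    = ⟦_⟧
    ; +-homo = λ where
        true  true  → sym 1+1≈0
        true  false → sym (+-identityʳ 1#)
        false y     → sym (+-identityˡ ⟦ y ⟧)
    ; *-homo = λ where
        true  y → sym (*-identityˡ ⟦ y ⟧)
        false y → sym (zeroˡ ⟦ y ⟧)
    ; -‿homo = λ where
        true  → GroupProperties.inverseˡ-unique +-group 1# 1# 1+1≈0
        false → sym (RingProperties.-0#≈0# ring)
    ; 0-homo = refl
    ; 1-homo = refl
    }

  ⟦⟧-≟ : ∀ x y → Maybe (⟦ x ⟧ ≈ ⟦ y ⟧)
  ⟦⟧-≟ x y = Maybe.map (reflexive ∘ ≡.cong ⟦_⟧) (dec⇒maybe (x ≟ᵇ y))

  open RingSolver F₂ (fromCommutativeRing R) F₂⟶R ⟦⟧-≟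
    using (Polynomial; solve; _:+_; _:*_; _:^_; _:=_; con)

  private
    𝟙 : ∀ {n} → Polynomial n
    𝟙 = con true

    module P {n} = Forms {A = Polynomial n} _:+_ _:*_ 𝟙

  open Forms _+_ _*_ 1# public

  infixl 6 _⊞_
  infixr 7 _⊠_

  -- Together with `_⊠_`, serves for ideal membership: a vanishing claim is proved by writing its
  -- left side as a combination of forms known to vanish, and the solver checks the combination.
  _⊞_ : ∀ {x y} → x ≈ 0# → y ≈ 0# → x + y ≈ 0#
  p ⊞ q = trans (+-cong p q) (+-identityˡ 0#)

  _⊠_ : ∀ x {y} → y ≈ 0# → x * y ≈ 0#
  x ⊠ p = trans (*-congˡ p) (zeroʳ x)

  x+x≈0 : ∀ x → x + x ≈ 0#
  x+x≈0 = solve 1 (λ x → x :+ x := con false) refl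

  x+y≈0⇒x≈y : ∀ {x y} → x + y ≈ 0# → x ≈ y
  x+y≈0⇒x≈y {x} {y} x+y≈0 = begin
    x            ≈⟨ solve 2 (λ x y → x := x :+ y :+ y) refl x y ⟩
    x + y + y    ≈⟨ +-congʳ x+y≈0 ⟩
    0# + y       ≈⟨ +-identityˡ y ⟩
    y            ∎

  x≈y⇒x+y≈0 : ∀ {x y} → x ≈ y → x + y ≈ 0#
  x≈y⇒x+y≈0 {x} {y} x≈y = trans (+-congʳ x≈y) (x+x≈0 y)

  -- Within each bracket the terms quadratic in the argument cancel; between the brackets the
  -- constant terms cancel. What is left is additive in the argument.
  trinomial-difference : ∀ a b c x y z x′ y′ z′ →
    (trinomial (x + a) (y + b) (z + c) + trinomial x y z + a * x)
    + (trinomial (x′ + a) (y′ + b) (z′ + c) + trinomial x′ y′ z′ + a * x′)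
    ≈ linearised a b c (x + x′) (y + y′) (z + z′)
  trinomial-difference = solve 9 (λ a b c x y z x′ y′ z′ →
    (P.trinomial (x :+ a) (y :+ b) (z :+ c) :+ P.trinomial x y z :+ a :* x)
    :+ (P.trinomial (x′ :+ a) (y′ :+ b) (z′ :+ c) :+ P.trinomial x′ y′ z′ :+ a :* x′)
    := P.linearised a b c (x :+ x′) (y :+ y′) (z :+ z′)) refl

  -- Cramer's rule for the system in x, y, z.
  linearised-kernel : ∀ a b c x y z →
    linearised a b c x y z ≈ 0# →
    linearised b c a y z x ≈ 0# →
    linearised c a b z x y ≈ 0# →
    norm a b c * x ≈ 0#
  linearised-kernel a b c x y z p q r = trans
    (solve 6 (λ a b c x y z →
      P.norm a b c :* x :=
      ((a :+ b) :* (b :+ c) :+ a :* (a :+ c)) :* P.linearised a b c x y z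
      :+ (c :* (b :+ c) :+ (a :+ b) :* (a :+ c)) :* P.linearised b c a y z x
      :+ (c :* a :+ (a :+ b) :* (a :+ b)) :* P.linearised c a b z x y)
      refl a b c x y z)
    (_ ⊠ p ⊞ _ ⊠ q ⊞ _ ⊠ r)

  -- Write n and d for the numerator and denominator. Where `linear a b c θ` vanishes at a root θ of
  -- `minimal`, n = θd, so `minimalʰ n d` is d³ times `minimal θ`, which is 0. Hence each conjugate
  -- factor of `norm`, and so `norm` itself, divides `minimalʰ n d`. The same reasoning applies to
  -- `linearʰ`.
  minimalʰ-quotient : ∀ a b c → norm a b c ≈ 0# →
    minimalʰ (numerator a b c) (denominator a b c) ≈ 0#
  minimalʰ-quotient a b c p = trans
    (solve 3 (λ a b c →
      P.minimalʰ (P.numerator a b c) (P.denominator a b c) :=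
      (b :* b :* b :+ b :* c :* c :+ c :* c :* c) :* P.norm a b c) refl a b c)
    (_ ⊠ p)

  linearʰ-quotient : ∀ a b c → norm a b c ≈ 0# →
    linearʰ a b c (numerator a b c) (denominator a b c) ≈ 0#
  linearʰ-quotient a b c p = trans
    (solve 3 (λ a b c →
      P.linearʰ a b c (P.numerator a b c) (P.denominator a b c) :=
      (c :* c) :* P.norm a b c) refl a b c)
    (_ ⊠ p)

  -- At d = 0 only the cube of n survives in `minimalʰ n d`.
  numerator³≈0 : ∀ a b c → norm a b c ≈ 0# → denominator a b c ≈ 0# →
    numerator a b c * (numerator a b c * numerator a b c) ≈ 0#
  numerator³≈0 a b c p q = trans
    (solve 2 (λ n d → n :* (n :* n) := P.minimalʰ n d :+ (n :* n :+ d :* d) :* d) refl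
      (numerator a b c) (denominator a b c))
    (minimalʰ-quotient a b c p ⊞ _ ⊠ q)

  -- In characteristic two, `(c * t + b + c) * linear a b c t` equals `c * c * minimal t +
  -- denominator a b c * t + numerator a b c`. When both quadratic forms vanish and c is nonzero, r
  -- = 1 + b/c is therefore a root of `minimal`, and the other two roots are roots of `linear`. One
  -- of these is r² = 1/(1 + r) = c/b, since r²(r + 1) = 1.
  minimalʰ-degenerate : ∀ a b c → numerator a b c ≈ 0# → denominator a b c ≈ 0# →
    minimalʰ c b ≈ 0#
  minimalʰ-degenerate a b c p q = trans
    (solve 3 (λ a b c →
      P.minimalʰ c b := c :* P.numerator a b c :+ (b :+ c) :* P.denominator a b c)
      refl a b c)
    (_ ⊠ p ⊞ _ ⊠ q)

  linearʰ-degenerate : ∀ a b c → numerator a b c ≈ 0# → denominator a b c ≈ 0# →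
    linearʰ a b c c b ≈ 0#
  linearʰ-degenerate a b c p q = trans
    (solve 3 (λ a b c →
      P.linearʰ a b c c b :=
      (b :+ c) :* P.numerator a b c :+ c :* P.denominator a b c)
      refl a b c)
    (_ ⊠ p ⊞ _ ⊠ q)

  -- Scaling by e³ and e² respectively turns the homogeneous forms into the affine ones up to a
  -- multiple of `d * e + 1#`, which vanishes.
  dehomogenise : ∀ a b c n d e → d * e ≈ 1# →
    minimalʰ n d ≈ 0# → linearʰ a b c n d ≈ 0# →
    minimal (n * e) ≈ 0# × linear a b c (n * e) ≈ 0#
  dehomogenise a b c n d e de≈1 p q =
    trans
      (solve 3 (λ n d e →
        P.minimal (n :* e) :=
        (e :* e :* e) :* P.minimalʰ n d
        :+ (n :* n :* e :* e :+ 𝟙 :+ d :* e :+ d :* e :* d :* e) :* (d :* e :+ 𝟙))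
        refl n d e)
      (_ ⊠ p ⊞ _ ⊠ de+1≈0) ,
    trans
      (solve 6 (λ a b c n d e →
        P.linear a b c (n :* e) :=
        (e :* e) :* P.linearʰ a b c n d
        :+ ((𝟙 :+ d :* e) :* (a :+ c) :+ n :* e :* b) :* (d :* e :+ 𝟙))
        refl a b c n d e)
      (_ ⊠ q ⊞ _ ⊠ de+1≈0)
    where
    de+1≈0 = x≈y⇒x+y≈0 de≈1

  -- The cofactors of the three forms are a row of the inverse of their coefficient matrix in a, b,
  -- c, taken modulo `minimal t`; the last term makes up for the reduction.
  linear-independence-fixed : ∀ a b c t → minimal t ≈ 0# →
    linear a b c t ≈ 0# → linear b c a t ≈ 0# → linear c a b t ≈ 0# → a ≈ 0#
  linear-independence-fixed a b c t p q r s = trans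
    (solve 4 (λ a b c t →
      a := (t :* t) :* P.linear a b c t :+ (t :+ 𝟙) :* P.linear b c a t
        :+ (t :* t :+ 𝟙) :* P.linear c a b t :+ (b :* t :+ c :* t :+ c) :* P.minimal t)
      refl a b c t)
    (_ ⊠ q ⊞ _ ⊠ r ⊞ _ ⊠ s ⊞ _ ⊠ p)

  -- The same matrix inversion, now with the root running through t, t⁴ and t¹⁶ = t².
  linear-independence-moved : ∀ a b c t → minimal t ≈ 0# →
    linear a b c t ≈ 0# → linear b c a (θ⁴-reduced t) ≈ 0# → linear c a b (t * t) ≈ 0# →
    a ≈ 0#
  linear-independence-moved a b c t p q r s = trans
    (solve 4 (λ a b c t →
      a := (t :* t) :* P.linear a b c t
        :+ (t :* t :+ t) :* P.linear b c a (P.θ⁴-reduced t)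
        :+ (t :* t :+ t) :* P.linear c a b (t :* t)
        :+ (a :* t :* t :* t :+ a :+ b :* t :* t :* t) :* P.minimal t)
      refl a b c t)
    (_ ⊠ q ⊞ _ ⊠ r ⊞ _ ⊠ s ⊞ _ ⊠ p)

  -- Powers of Frobenius and their action on the roots of `minimal`.

  frobenius : ℕ → Carrier → Carrier
  frobenius k x = x ^ (2 ℕ.^ k)

  frobenius-cong : ∀ k {x y} → x ≈ y → frobenius k x ≈ frobenius k y
  frobenius-cong k = ^-congˡ (2 ℕ.^ k)

  frobenius-* : ∀ k x y → frobenius k (x * y) ≈ frobenius k x * frobenius k y
  frobenius-* k x y = ^-distrib-* x y (2 ℕ.^ k)

  frobenius-∘ : ∀ j k x → frobenius j (frobenius k x) ≈ frobenius (j ℕ.+ k) x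
  frobenius-∘ j k x = trans (^-assocʳ x (2 ℕ.^ k) (2 ℕ.^ j)) (^-congʳ x (≡.trans
    (ℕ.*-comm (2 ℕ.^ k) (2 ℕ.^ j)) (≡.sym (ℕ.^-distribˡ-+-* 2 j k))))

  frobenius-+ : ∀ k x y → frobenius k (x + y) ≈ frobenius k x + frobenius k y
  frobenius-+ zero    x y = solve 2 (λ x y → (x :+ y) :^ 1 := x :^ 1 :+ y :^ 1) refl x y
  frobenius-+ (suc k) x y = begin
    frobenius (suc k) (x + y)                      ≈⟨ ^-assocʳ (x + y) 2 (2 ℕ.^ k) ⟨
    frobenius k ((x + y) ^ 2)                      ≈⟨ frobenius-cong k
      (solve 2 (λ x y → (x :+ y) :^ 2 := x :^ 2 :+ y :^ 2) refl x y) ⟩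
    frobenius k (x ^ 2 + y ^ 2)                    ≈⟨ frobenius-+ k (x ^ 2) (y ^ 2) ⟩
    frobenius k (x ^ 2) + frobenius k (y ^ 2)      ≈⟨ +-cong
      (^-assocʳ x 2 (2 ℕ.^ k)) (^-assocʳ y 2 (2 ℕ.^ k)) ⟩
    frobenius (suc k) x + frobenius (suc k) y      ∎

  frobenius-0# : ∀ k → frobenius k 0# ≈ 0#
  frobenius-0# k = begin
    frobenius k 0#                    ≈⟨ frobenius-cong k (+-identityˡ 0#) ⟨
    frobenius k (0# + 0#)             ≈⟨ frobenius-+ k 0# 0# ⟩
    frobenius k 0# + frobenius k 0#   ≈⟨ x+x≈0 _ ⟩
    0#                                ∎

  frobenius-1# : ∀ k → frobenius k 1# ≈ 1#
  frobenius-1# k = 1^n≈1 (2 ℕ.^ k)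
    where
    1^n≈1 : ∀ n → 1# ^ n ≈ 1#
    1^n≈1 zero    = refl
    1^n≈1 (suc n) = trans (*-identityˡ _) (1^n≈1 n)

  frobenius-iterate : ∀ j k {x} → frobenius j x ≈ x → frobenius (k ℕ.* j) x ≈ x
  frobenius-iterate j zero    {x} p = *-identityʳ x
  frobenius-iterate j (suc k) {x} p = begin
    frobenius (j ℕ.+ k ℕ.* j) x             ≈⟨ frobenius-∘ j (k ℕ.* j) x ⟨
    frobenius j (frobenius (k ℕ.* j) x)     ≈⟨ frobenius-cong j (frobenius-iterate j k p) ⟩
    frobenius j x                           ≈⟨ p ⟩
    x                                       ∎

  module _ {t} (mt≈0 : minimal t ≈ 0#) where

    frobenius-2-root : frobenius 2 t ≈ θ⁴-reduced t
    frobenius-2-root = x+y≈0⇒x≈y (trans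
      (solve 1 (λ t → t :^ 4 :+ P.θ⁴-reduced t := (t :+ 𝟙) :* P.minimal t) refl t)
      (_ ⊠ mt≈0))

    frobenius-3-root : frobenius 3 t ≈ t
    frobenius-3-root = x+y≈0⇒x≈y (trans
      (solve 1 (λ t → t :^ 8 :+ t := (t :^ 5 :+ t :^ 4 :+ t :^ 3 :+ t) :* P.minimal t) refl t)
      (_ ⊠ mt≈0))

    θ⁴-reduced² : θ⁴-reduced (θ⁴-reduced t) ≈ t * t
    θ⁴-reduced² = x+y≈0⇒x≈y (trans
      (solve 1 (λ t → P.θ⁴-reduced (P.θ⁴-reduced t) :+ t :* t := (t :+ 𝟙) :* P.minimal t) refl t)
      (_ ⊠ mt≈0))

    -- A root satisfies t⁸ = t, so only m modulo 3 matters. The excluded residue would send t to t²,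
    -- and then the three conjugate linear forms are proportional instead of independent.
    frobenius-root : ∀ m → m ℕ.% 3 ≢ 1 →
      frobenius m t ≈ t ⊎ frobenius m t ≈ θ⁴-reduced t
    frobenius-root m m%3≢1 with m ℕ.% 3 | m≡m%n+[m/n]*n m 3 | m%n<n m 3
    ... | 0 | m≡ | _ = inj₁ (trans (reflexive (≡.cong (λ n → frobenius n t) m≡))
                            (frobenius-iterate 3 (m ℕ./ 3) frobenius-3-root))
    ... | 1 | _  | _ = contradiction ≡.refl m%3≢1
    ... | 2 | m≡ | _ = inj₂ (begin
      frobenius m t                                ≡⟨ ≡.cong (λ n → frobenius n t) m≡ ⟩
      frobenius (2 ℕ.+ m ℕ./ 3 ℕ.* 3) t            ≈⟨ frobenius-∘ 2 (m ℕ./ 3 ℕ.* 3) t ⟨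
      frobenius 2 (frobenius (m ℕ./ 3 ℕ.* 3) t)    ≈⟨ frobenius-cong 2
        (frobenius-iterate 3 (m ℕ./ 3) frobenius-3-root) ⟩
      frobenius 2 t                                ≈⟨ frobenius-2-root ⟩
      θ⁴-reduced t                                 ∎)
    ... | suc (suc (suc _)) | _ | ℕ.s≤s (ℕ.s≤s (ℕ.s≤s ()))

  -- Conjugating equations by σ.

  module Conjugation (m : ℕ) where

    σ : Carrier → Carrier
    σ = frobenius m

    infix 4 _↦_
    infixl 6 _+↦_
    infixl 7 _*↦_

    -- A relation rather than an equation, so that the image of a form is assembled along its syntax
    -- from the images of its letters.
    _↦_ : Carrier → Carrier → Set ℓ
    x ↦ x′ = σ x ≈ x′

    _+↦_ : ∀ {x x′ y y′} → x ↦ x′ → y ↦ y′ → x + y ↦ x′ + y′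
    p +↦ q = trans (frobenius-+ m _ _) (+-cong p q)

    _*↦_ : ∀ {x x′ y y′} → x ↦ x′ → y ↦ y′ → x * y ↦ x′ * y′
    p *↦ q = trans (frobenius-* m _ _) (*-cong p q)

    vanishing : ∀ {x x′} → x ↦ x′ → x ≈ 0# → x′ ≈ 0#
    vanishing p x≈0 = trans (sym p) (trans (frobenius-cong m x≈0) (frobenius-0# m))

    linearised-↦ : ∀ {a a′ b b′ c c′ x x′ y y′ z z′} →
      a ↦ a′ → b ↦ b′ → c ↦ c′ → x ↦ x′ → y ↦ y′ → z ↦ z′ →
      linearised a b c x y z ↦ linearised a′ b′ c′ x′ y′ z′
    linearised-↦ a b c x y z = x *↦ (a +↦ c) +↦ y *↦ c +↦ z *↦ (a +↦ b)

    linear-↦ : ∀ {a a′ b b′ c c′ t t′} →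
      a ↦ a′ → b ↦ b′ → c ↦ c′ → t ↦ t′ → linear a b c t ↦ linear a′ b′ c′ t′
    linear-↦ a b c t = a +↦ c +↦ t *↦ b +↦ t *↦ t *↦ c

    θ⁴-reduced-↦ : ∀ {t t′} → t ↦ t′ → θ⁴-reduced t ↦ θ⁴-reduced t′
    θ⁴-reduced-↦ t = t *↦ t +↦ t +↦ frobenius-1# m

    -- Applying σ once and twice to the single equation cycles a, b, c and moves t, which supplies
    -- the other two equations of the linear system.
    linear-independence : m ℕ.% 3 ≢ 1 → ∀ {a b c t} → a ↦ b → b ↦ c → c ↦ a →
      minimal t ≈ 0# → linear a b c t ≈ 0# → a ≈ 0#
    linear-independence m%3≢1 {a} {b} {c} {t} a↦b b↦c c↦a p q with frobenius-root p m m%3≢1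
    ... | inj₁ t↦t = linear-independence-fixed a b c t p q q′ q″
      where
      q′ = vanishing (linear-↦ a↦b b↦c c↦a t↦t) q
      q″ = vanishing (linear-↦ b↦c c↦a a↦b t↦t) q′
    ... | inj₂ t↦t⁴ = linear-independence-moved a b c t p q q′ q″
      where
      q′ = vanishing (linear-↦ a↦b b↦c c↦a t↦t⁴) q
      q″ = vanishing
        (linear-↦ b↦c c↦a a↦b (trans (θ⁴-reduced-↦ t↦t⁴) (θ⁴-reduced² p))) q′

-- Finite sets and sums over them.

injective⇒surjective : ∀ {n} (f : Fin n → Fin n) → Injective _≡_ _≡_ f →
                       ∀ j → ∃[ i ] f i ≡ j
injective⇒surjective {suc n} f f-injective j with any? (λ i → f i ≟ᶠ j)
... | yes hit = hit
-- If j is missed, punching it out leaves an injection of `Fin (suc n)` into `Fin n`.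
... | no miss = contradiction
  (injective⇒≤ (f-injective ∘ punchOut-injective (j≢f _) (j≢f _))) ℕ.1+n≰n
  where
  j≢f : ∀ i → j ≢ f i
  j≢f i j≡fi = miss (i , ≡.sym j≡fi)

module FiniteSetoid {a ℓ} {S : Setoid a ℓ} {n} (enumeration : Inverse S (≡.setoid (Fin n))) where
  open Setoid S
  open Inverse enumeration public

  from∘to : ∀ x → from (to x) ≈ x
  from∘to x = inverseʳ ≡.refl

  to-injective : ∀ {x y} → to x ≡ to y → x ≈ y
  to-injective {x} {y} p = trans (sym (from∘to x)) (inverseʳ p)

  _≟_ : Decidable _≈_
  x ≟ y = map′ to-injective to-cong (to x ≟ᶠ to y)

  injective⇒isBijection : ∀ {f} → Congruent _≈_ _≈_ f → Injective _≈_ _≈_ f →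
                          IsBijection _≈_ _≈_ f
  injective⇒isBijection {f} f-cong f-injective = record
    { isInjection = record
      { isCongruent = record
        { cong           = f-cong
        ; isEquivalence₁ = isEquivalence
        ; isEquivalence₂ = isEquivalence
        }
      ; injective = f-injective
      }
    ; surjective = surjective
    }
    where
    surjective : Surjective _≈_ _≈_ f
    surjective y with i , p ← injective⇒surjective (to ∘ f ∘ from)
        (λ {i} {j} p → ≡.trans (≡.sym (inverseˡ refl))
          (≡.trans (to-cong (f-injective (to-injective p))) (inverseˡ refl)))
        (to y)
      = from i , λ z≈ → trans (f-cong z≈) (to-injective p)

  module _ {b ℓ′} (M : CommutativeMonoid b ℓ′) where
    private module M = CommutativeMonoid M
    open Sum M

    -- Conjugating π by the enumeration gives a permutation of the indices. The monoid is left
    -- general in order to cover both sums and products of field elements.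
    sum-reindex : (π : Inverse S S) (f : Carrier → M.Carrier) → Congruent _≈_ M._≈_ f →
                  sum (f ∘ from) M.≈ sum (f ∘ Inverse.to π ∘ from)
    sum-reindex π f f-cong = M.trans
      (sum-permute (f ∘ from) ((invert enumeration ⨾ π) ⨾ enumeration))
      (sum-cong-≋ (λ i → f-cong (from∘to (Inverse.to π (from i)))))

    sum-indicator : ∀ {k} (j : Fin k) x →
      sum (λ i → if does (i ≟ᶠ j) then x else M.ε) M.≈ x
    sum-indicator {suc k} zero x = M.trans (M.∙-congˡ (sum-replicate-zero k)) (M.identityʳ x)
    sum-indicator {suc k} (suc j) x = M.trans (M.identityˡ _) (sum-indicator j x)

-- Finite fields: inverses, characteristic and Fermat's theorem.

module FiniteField {c ℓ₁ ℓ₂} (K : HeytingField c ℓ₁ ℓ₂) {q} (order : HasOrder K q) where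
  R : CommutativeRing c ℓ₁
  R = HeytingCommutativeRing.commutativeRing (HeytingField.heytingCommutativeRing K)

  open CommutativeRing R hiding (zero)
  open FiniteSetoid order public
  open Exp commutativeSemiring
  open Mult semiring using (×1-homo-*; ×-homo-1) renaming (_×_ to _·_)
  open SetoidReasoning setoid

  private
    module Π = Sum *-commutativeMonoid
    module Σ = Sum +-commutativeMonoid

  -- The field axioms invert only what is apart from 0. A finite search decides whether an inverse
  -- exists; if none does, x is not apart from 0, and tightness gives `x ≈ 0#`.
  inverse-exists : ∀ {x} → x ≉ 0# → ∃[ y ] x * y ≈ 1#
  inverse-exists {x} x≉0 with any? (λ i → (x * from i) ≟ 1#)
  ... | yes (i , p) = from i , p
  ... | no  none    = contradiction (proj₁ (HeytingField.tight K x 0#) not-apart) x≉0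
    where
    not-apart : ¬ (HeytingField._#_ K x 0#)
    not-apart x#0 with y , _ , p ← HeytingField.#⇒invertible K x#0 = none (to y , (begin
      x * from (to y)   ≈⟨ *-congˡ (from∘to y) ⟩
      x * y             ≈⟨ *-congʳ (trans (+-congˡ (RingProperties.-0#≈0# ring)) (+-identityʳ x)) ⟨
      (x - 0#) * y      ≈⟨ p ⟩
      1#                ∎))

  *-cancelˡ : ∀ {x y z} → x ≉ 0# → x * y ≈ x * z → y ≈ z
  *-cancelˡ {x} {y} {z} x≉0 xy≈xz with x⁻¹ , p ← inverse-exists x≉0 =
    trans (sym (unscale y)) (trans (*-congˡ xy≈xz) (unscale z))
    where
    unscale : ∀ y → x⁻¹ * (x * y) ≈ y
    unscale y = begin
      x⁻¹ * (x * y)   ≈⟨ *-assoc x⁻¹ x y ⟨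
      x⁻¹ * x * y     ≈⟨ *-congʳ (trans (*-comm x⁻¹ x) p) ⟩
      1# * y          ≈⟨ *-identityˡ y ⟩
      y               ∎

  x≉0∧xy≈0⇒y≈0 : ∀ {x y} → x ≉ 0# → x * y ≈ 0# → y ≈ 0#
  x≉0∧xy≈0⇒y≈0 {x} x≉0 xy≈0 = *-cancelˡ x≉0 (trans xy≈0 (sym (zeroʳ x)))

  1≈0⇒x≈0 : 1# ≈ 0# → ∀ x → x ≈ 0#
  1≈0⇒x≈0 1≈0 x = trans (sym (*-identityʳ x)) (trans (*-congˡ 1≈0) (zeroʳ x))

  translation : Carrier → Inverse setoid setoid
  translation a = record
    { to        = _+ a
    ; from      = _- a
    ; to-cong   = +-congʳ
    ; from-cong = +-congʳ
    ; inverse   = (λ p → trans (+-congʳ p) (GroupProperties.//-rightDividesˡ +-group a _))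
                , (λ p → trans (+-congʳ p) (GroupProperties.//-rightDividesʳ +-group a _))
    }

  scaling : ∀ {a b} → a * b ≈ 1# → Inverse setoid setoid
  scaling {a} {b} ab≈1 = record
    { to        = a *_
    ; from      = b *_
    ; to-cong   = *-congˡ
    ; from-cong = *-congˡ
    ; inverse   = (λ p → trans (*-congˡ p) (cancel ab≈1 _))
                , (λ p → trans (*-congˡ p) (cancel (trans (*-comm b a) ab≈1) _))
    }
    where
    cancel : ∀ {u v} → u * v ≈ 1# → ∀ x → u * (v * x) ≈ x
    cancel {u} {v} uv≈1 x = trans (sym (*-assoc u v x)) (trans (*-congʳ uv≈1) (*-identityˡ x))

  -- Translation by 1 permutes the field, so adding 1 to each of the q summands leaves the sum of
  -- all elements unchanged.
  order×1≈0 : q · 1# ≈ 0#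
  order×1≈0 = GroupProperties.identityʳ-unique +-group (Σ.sum from) (q · 1#) (begin
    Σ.sum from + q · 1#                       ≈⟨ +-congˡ (Σ.sum-replicate q) ⟨
    Σ.sum from + Σ.sum {q} (λ _ → 1#)         ≈⟨ Σ.∑-distrib-+ from (λ _ → 1#) ⟨
    Σ.sum (λ i → from i + 1#)                 ≈⟨ sum-reindex +-commutativeMonoid
      (translation 1#) id id ⟨
    Σ.sum from                                ∎)

  -- A nonzero 2 could be cancelled factor by factor, down to `1# ≈ 0#`, where everything vanishes.
  2^k×1≈0⇒1+1≈0 : ∀ k → (2 ℕ.^ k) · 1# ≈ 0# → 1# + 1# ≈ 0#
  2^k×1≈0⇒1+1≈0 zero p = 1≈0⇒x≈0 (trans (sym (×-homo-1 1#)) p) _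
  2^k×1≈0⇒1+1≈0 (suc k) p with (2 · 1#) ≟ 0#
  ... | yes 2≈0 = trans (+-congˡ (sym (×-homo-1 1#))) 2≈0
  ... | no  2≉0 = 2^k×1≈0⇒1+1≈0 k (x≉0∧xy≈0⇒y≈0 2≉0 (trans (sym (×1-homo-* 2 (2 ℕ.^ k))) p))

  ∏-nonzero : 1# ≉ 0# → ∀ {k} (t : Fin k → Carrier) → (∀ i → t i ≉ 0#) → Π.sum t ≉ 0#
  ∏-nonzero 1≉0 {zero}  t t≉0 = 1≉0
  ∏-nonzero 1≉0 {suc k} t t≉0 p =
    ∏-nonzero 1≉0 (t ∘ suc) (t≉0 ∘ suc) (x≉0∧xy≈0⇒y≈0 (t≉0 zero) p)

  -- The product of x over x ≠ 0 is invariant under scaling by a.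
  fermat : .{{NonZero q}} → ∀ a → a ^ q ≈ a
  fermat a with a ≟ 0#
  ... | yes a≈0 = trans (^-congˡ q a≈0) (trans (0^n≈0 q) (sym a≈0))
    where
    0^n≈0 : ∀ n → .{{NonZero n}} → 0# ^ n ≈ 0#
    0^n≈0 (suc n) = zeroˡ _
  ... | no a≉0 with a⁻¹ , aa⁻¹≈1 ← inverse-exists a≉0 = begin
      a ^ q                                          ≈⟨ Π.sum-replicate q ⟨
      Π.sum {q} (λ _ → a)                            ≈⟨ Π.sum-cong-≋ split ⟨
      Π.sum (λ i → factor i * defect i)              ≈⟨ Π.∑-distrib-+ factor defect ⟩
      Π.sum factor * Π.sum defect                    ≈⟨ *-cong ∏factor≈1
        (sum-indicator *-commutativeMonoid (to 0#) a) ⟩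
      1# * a                                         ≈⟨ *-identityˡ a ⟩
      a                                              ∎
    where
    1≉0 : 1# ≉ 0#
    1≉0 1≈0 = a≉0 (1≈0⇒x≈0 1≈0 a)

    -- Replacing 0 by 1 lets the product over nonzero elements run over all of `Fin q` and stay
    -- cancellable.
    unit : Carrier → Carrier
    unit x = if does (to x ≟ᶠ to 0#) then 1# else x

    -- The q copies of a are split into those at nonzero elements, whose product is shown to be 1,
    -- and the single one at 0, which remains as the result.
    factor defect : Fin q → Carrier
    factor i = if does (i ≟ᶠ to 0#) then 1# else a
    defect i = if does (i ≟ᶠ to 0#) then a else 1#

    split : ∀ i → factor i * defect i ≈ a
    split i with does (i ≟ᶠ to 0#)
    ... | true  = *-identityˡ a
    ... | false = *-identityʳ a

    unit-nonzero : ∀ x → unit x ≉ 0#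
    unit-nonzero x with to x ≟ᶠ to 0#
    ... | yes _ = 1≉0
    ... | no  p = p ∘ to-cong

    unit-cong : Congruent _≈_ _≈_ unit
    unit-cong {x} {y} x≈y rewrite to-cong x≈y with to y ≟ᶠ to 0#
    ... | yes _ = refl
    ... | no  _ = x≈y

    unit-scale : ∀ i → unit (a * from i) ≈ factor i * unit (from i)
    unit-scale i rewrite inverseˡ (refl {from i}) with i ≟ᶠ to 0# | to (a * from i) ≟ᶠ to 0#
    ... | yes _ | yes _ = sym (*-identityˡ 1#)
    ... | no  _ | no  _ = refl
    ... | yes ≡.refl | no p = contradiction (to-cong (trans (*-congˡ (from∘to 0#)) (zeroʳ a))) p
    ... | no p | yes r = contradiction
      (≡.trans (≡.sym (inverseˡ refl)) (to-cong (x≉0∧xy≈0⇒y≈0 a≉0 (to-injective r)))) p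

    ∏unit : Carrier
    ∏unit = Π.sum (unit ∘ from)

    ∏factor≈1 : Π.sum factor ≈ 1#
    ∏factor≈1 = *-cancelˡ (∏-nonzero 1≉0 (unit ∘ from) (unit-nonzero ∘ from)) (begin
      ∏unit * Π.sum factor                       ≈⟨ *-comm ∏unit _ ⟩
      Π.sum factor * ∏unit                       ≈⟨ Π.∑-distrib-+ factor (unit ∘ from) ⟨
      Π.sum (λ i → factor i * unit (from i))     ≈⟨ Π.sum-cong-≋ unit-scale ⟨
      Π.sum (λ i → unit (a * from i))            ≈⟨ sum-reindex *-commutativeMonoid
        (scaling aa⁻¹≈1) unit unit-cong ⟨
      ∏unit                                      ≈⟨ *-identityʳ ∏unit ⟨
      ∏unit * 1#                                 ∎)

-- The field of order 2^(3m) and pseudo-planarity.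

module Cubic {c ℓ₁ ℓ₂} (m : ℕ) (m%3≢1 : m ℕ.% 3 ≢ 1)
  (K : HeytingField c ℓ₁ ℓ₂) (order : HasOrder K (2 ℕ.^ (3 ℕ.* m))) where

  open FiniteField K order
  open CommutativeRing R hiding (zero)
  open Exp commutativeSemiring
  open CharacteristicTwo R (2^k×1≈0⇒1+1≈0 (3 ℕ.* m) order×1≈0)
  open Conjugation m
  open SetoidReasoning setoid

  σ³≈id : ∀ x → σ (σ (σ x)) ≈ x
  σ³≈id x = begin
    σ (σ (σ x))                      ≈⟨ frobenius-cong m (frobenius-∘ m m x) ⟩
    σ (frobenius (m ℕ.+ m) x)        ≈⟨ frobenius-∘ m (m ℕ.+ m) x ⟩
    -- `3 * m` unfolds to `m + (m + (m + 0))`.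
    frobenius (m ℕ.+ (m ℕ.+ m)) x    ≡⟨ ≡.cong (λ n → frobenius (m ℕ.+ (m ℕ.+ n)) x)
      (ℕ.+-identityʳ m) ⟨
    x ^ (2 ℕ.^ (3 ℕ.* m))            ≈⟨ fermat {{ℕ.m^n≢0 2 (3 ℕ.* m)}} x ⟩
    x                                ∎

  σ-nonzero : ∀ {x} → x ≉ 0# → σ x ≉ 0#
  σ-nonzero x≉0 p = x≉0 (vanishing (σ³≈id _) (vanishing refl p))

  root-exists : ∀ {a b c} → b ≉ 0# → norm a b c ≈ 0# →
    ∃[ t ] minimal t ≈ 0# × linear a b c t ≈ 0#
  root-exists {a} {b} {c} b≉0 N≈0 = root
    where
    dehomogenised : ∀ {n d} → d ≉ 0# → minimalʰ n d ≈ 0# → linearʰ a b c n d ≈ 0# →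
      ∃[ t ] minimal t ≈ 0# × linear a b c t ≈ 0#
    dehomogenised {n} {d} d≉0 p r with e , de≈1 ← inverse-exists d≉0 =
      n * e , dehomogenise a b c n d e de≈1 p r

    root : ∃[ t ] minimal t ≈ 0# × linear a b c t ≈ 0#
    root with denominator a b c ≟ 0#
    ... | no  d≉0 = dehomogenised d≉0 (minimalʰ-quotient a b c N≈0) (linearʰ-quotient a b c N≈0)
    ... | yes d≈0 with numerator a b c ≟ 0#
    ...   | yes n≈0 = dehomogenised b≉0
                        (minimalʰ-degenerate a b c n≈0 d≈0) (linearʰ-degenerate a b c n≈0 d≈0)
    -- A zero denominator forces the cube of the numerator to vanish; cancelling twice kills the
    -- numerator itself.
    ...   | no  n≉0 = contradiction
                        (x≉0∧xy≈0⇒y≈0 n≉0 (x≉0∧xy≈0⇒y≈0 n≉0 (numerator³≈0 a b c N≈0 d≈0))) n≉0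

  norm-nonzero : ∀ {a} → a ≉ 0# → norm a (σ a) (σ (σ a)) ≉ 0#
  norm-nonzero {a} a≉0 N≈0 with t , p , r ← root-exists (σ-nonzero a≉0) N≈0 =
    a≉0 (linear-independence m%3≢1 refl refl (σ³≈id a) p r)

  binomial≈trinomial : ∀ x → binomial K m x ≈ trinomial x (σ x) (σ (σ x))
  binomial≈trinomial x = +-cong
    (begin
      x ^ (2 ℕ.^ (2 ℕ.* m) ℕ.+ 1)          ≈⟨ ^-homo-* x (2 ℕ.^ (2 ℕ.* m)) 1 ⟩
      frobenius (2 ℕ.* m) x * x ^ 1        ≈⟨ *-cong frobenius-2m (*-identityʳ x) ⟩
      σ (σ x) * x                          ≈⟨ *-comm _ x ⟩
      x * σ (σ x)                          ∎)
    (trans (^-homo-* x (2 ℕ.^ (2 ℕ.* m)) (2 ℕ.^ m)) (*-congʳ frobenius-2m))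
    where
    frobenius-2m : frobenius (2 ℕ.* m) x ≈ σ (σ x)
    frobenius-2m = trans
      (reflexive (≡.cong (λ n → frobenius (m ℕ.+ n) x) (ℕ.+-identityʳ m)))
      (sym (frobenius-∘ m m x))

  linearised-injective : ∀ {a x} → a ≉ 0# →
    linearised a (σ a) (σ (σ a)) x (σ x) (σ (σ x)) ≈ 0# → x ≈ 0#
  linearised-injective {a} {x} a≉0 p =
    x≉0∧xy≈0⇒y≈0 (norm-nonzero a≉0) (linearised-kernel _ _ _ _ _ _ p p′ p″)
    where
    -- The conjugates of the one equation complete the system; `σ³≈id` brings the third conjugates
    -- back to a and x.
    p′ = vanishing (linearised-↦ refl refl (σ³≈id a) refl refl (σ³≈id x)) p
    p″ = vanishing (linearised-↦ refl (σ³≈id a) refl refl (σ³≈id x) refl) p′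

  -- By finiteness injectivity suffices, and a collision of x and y makes the linearised form vanish
  -- at `x + y`.
  isPseudoPlanar : IsPseudoPlanar K (binomial K m)
  isPseudoPlanar ε ε≉0 = injective⇒isBijection
    (λ p → +-cong (+-cong (binomial-cong (+-congʳ p)) (binomial-cong p)) (*-congˡ p))
    (λ {x} {y} p → x+y≈0⇒x≈y (linearised-injective ε≉0 (begin
      linearised ε (σ ε) (σ (σ ε)) (x + y) (σ (x + y)) (σ (σ (x + y)))
        ≈⟨ +-cong (+-congˡ (*-congʳ σ+)) (*-congʳ σσ+) ⟩
      linearised ε (σ ε) (σ (σ ε)) (x + y) (σ x + σ y) (σ (σ x) + σ (σ y))
        ≈⟨ trinomial-difference ε (σ ε) (σ (σ ε)) x (σ x) (σ (σ x)) y (σ y) (σ (σ y)) ⟨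
      _ ≈⟨ +-cong (expand x) (expand y) ⟨
      _ ≈⟨ x≈y⇒x+y≈0 p ⟩
      0# ∎)))
    where
    binomial-cong : Congruent _≈_ _≈_ (binomial K m)
    binomial-cong p = +-cong
      (^-congˡ (2 ℕ.^ (2 ℕ.* m) ℕ.+ 1) p) (^-congˡ (2 ℕ.^ (2 ℕ.* m) ℕ.+ 2 ℕ.^ m) p)

    σ+ : ∀ {x y} → σ (x + y) ≈ σ x + σ y
    σ+ = frobenius-+ m _ _

    σσ+ : ∀ {x y} → σ (σ (x + y)) ≈ σ (σ x) + σ (σ y)
    σσ+ = trans (frobenius-cong m σ+) σ+

    expand : ∀ x → binomial K m (x + ε) + binomial K m x + ε * x ≈
      trinomial (x + ε) (σ x + σ ε) (σ (σ x) + σ (σ ε)) + trinomial x (σ x) (σ (σ x)) + ε * x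
    expand x = +-congʳ (+-cong
      (trans (binomial≈trinomial (x + ε)) (+-cong (*-congˡ σσ+) (*-cong σσ+ σ+)))
      (binomial≈trinomial x))

open import Data.Nat.Base using (_*_; _^_; _%_)

proposition3p8 : ∀ {c ℓ₁ ℓ₂} (m : ℕ) → .{{_ : NonZero m}} → m % 3 ≢ 1 →
    (K : HeytingField c ℓ₁ ℓ₂) → HasOrder K (2 ^ (3 * m)) →
    IsPseudoPlanar K (binomial K m)
proposition3p8 m m%3≢1 K order = Cubic.isPseudoPlanar m m%3≢1 K order
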